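{- Let $\models$ be an intersective mixed consequence truth-relation on a finite set $V$ of truth values (constant expressive setting). If $\models$ admits a G-negation, then every minimal representation $\models_{\mathcal{D}_p^1,\mathcal{D}_c^1}\cap\dots\cap\models_{\mathcal{D}_p^K,\mathcal{D}_c^K}$ of $\models$ satisfies: (N1) for $i\neq j$ there is no inclusion $\mathcal{D}_p^i\subseteq\mathcal{D}_p^j$ nor $\mathcal{D}_c^i\subseteq\mathcal{D}_c^j$; (N2) for all $i,j$: if $\mathcal{D}_p^i\subseteq\mathcal{D}_c^j$ then $\mathcal{D}_p^j\subseteq\mathcal{D}_c^i$, and if $\mathcal{D}_c^j\subseteq\mathcal{D}_p^i$ then $\mathcal{D}_c^i\subseteq\mathcal{D}_p^j$.
   Context: $V$ contains distinct $1,0$; sets of designated values: $\mathcal{D}\subseteq V$, $1\in\mathcal{D}$, $0\notin\mathcal{D}$. $\gamma\models_{\mathcal{D}_p,\mathcal{D}_c}\delta$ iff ($\gamma\subseteq\mathcal{D}_p\Rightarrow\delta\cap\mathcal{D}_c\neq\emptyset$). An intersective mixed truth-relation is a finite intersection of such; a representation is a list of mixed relations whose intersection it is, minimal if of least possible length. Semantics: valuations mapping atoms to $V$, connectives interpreted by fixed truth functions, extended compositionally, every assignment to finitely many distinct atoms realized; constant expressive: every value is the constant value of some formula. $\Gamma\vdash\Delta$ iff $v(\Gamma)\models v(\Delta)$ for all $v$. A G-negation is a unary connective $\neg$ (interpreted by some truth function) with, for all $\Gamma,\Delta,A$: $\Gamma\cup\{\neg A\}\vdash\Delta$ iff $\Gamma\vdash\{A\}\cup\Delta$;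 and $\Gamma\vdash\{\neg A\}\cup\Delta$ iff $\Gamma\cup\{A\}\vdash\Delta$. -}

module Defs where

open import Data.Fin.Base using (Fin)
open import Data.Fin.Subset as Subset using (Subset)
open import Data.List.Base using (List; length)
open import Data.List.Relation.Unary.All using (All)
open import Data.Nat.Base using (ℕ; _≤_)
open import Data.Product.Base using (∃; _×_)
open import Data.Vec.Base using (Vec; []; _∷_)
open import Function.Bundles using (_⇔_)
open import Function.Definitions using (Injective)
open import Level using (0ℓ)
open import Relation.Binary.Core using (Rel)
open import Relation.Binary.PropositionalEquality.Core using (_≡_; _≢_)
open import Relation.Unary using (Pred; _∈_; _⊆_; _∪_; _∩_; ｛_｝; Satisfiable)

-- A finite set of truth values, enumerated as Fin size.  The distinguished
-- values 𝟏 and 𝟎 are arbitrary distinct elements of it.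
record TruthValues : Set where
  field
    size : ℕ
  V : Set
  V = Fin size
  field
    𝟏 𝟎 : V
    𝟏≢𝟎 : 𝟏 ≢ 𝟎

module _ (𝒱 : TruthValues) where
  open TruthValues 𝒱

  -- Designated sets are decidable subsets of V, whereas the arguments γ, δ of
  -- a truth-relation are arbitrary predicates: the image of an arbitrary set
  -- of formulas need not be decidable.

  record Designated : Set where
    field
      values : Subset size
      𝟏∈values : 𝟏 Subset.∈ values
      𝟎∉values : 𝟎 Subset.∉ values

  TruthRelation : Set₁
  TruthRelation = Rel (Pred V 0ℓ) 0ℓ

  record Mixed : Set where
    field
      premise conclusion : Designated

    Dp Dc : Subset size
    Dp = Designated.values premise
    Dc = Designated.values conclusion

    relation : TruthRelation
    relation γ δ =
      γ ⊆ (Subset._∈ Dp) → Satisfiable (δ ∩ (Subset._∈ Dc))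

  Represents : List Mixed → TruthRelation → Set₁
  Represents Ms _⊨_ =
    ∀ γ δ → (γ ⊨ δ) ⇔ All (λ M → Mixed.relation M γ δ) Ms

  IntersectiveMixed : TruthRelation → Set₁
  IntersectiveMixed _⊨_ = ∃ λ Ms → Represents Ms _⊨_

  MinimalRepresentation : List Mixed → TruthRelation → Set₁
  MinimalRepresentation Ms _⊨_ =
    Represents Ms _⊨_ ×
    (∀ Ms′ → Represents Ms′ _⊨_ → length Ms ≤ length Ms′)

data Formula (Atom : Set) (Connective : ℕ → Set) : Set where
  atom : Atom → Formula Atom Connective
  app  : ∀ {k} → Connective k → Vec (Formula Atom Connective) k →
         Formula Atom Connective

record Semantics (𝒱 : TruthValues) : Set₁ where
  open TruthValues 𝒱
  field
    Atom       : Set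
    Connective : ℕ → Set
    ⟦_⟧        : ∀ {k} → Connective k → Vec V k → V
    -- Valuations are given by their restriction to atoms; not every map from
    -- atoms to V has to be one.
    Valuation  : Pred (Atom → V) 0ℓ
    realized   : ∀ {k} (p : Fin k → Atom) → Injective _≡_ _≡_ p →
                 (x : Fin k → V) →
                 ∃ λ v → v ∈ Valuation × (∀ i → v (p i) ≡ x i)

  Form : Set
  Form = Formula Atom Connective

  eval  : (Atom → V) → Form → V
  evals : ∀ {k} → (Atom → V) → Vec Form k → Vec V k

  eval v (atom p)   = v p
  eval v (app c As) = ⟦ c ⟧ (evals v As)

  evals v []       = []
  evals v (A ∷ As) = eval v A ∷ evals v As

  image : (Atom → V) → Pred Form 0ℓ → Pred V 0ℓ
  image v Γ x = ∃ λ A → A ∈ Γ × eval v A ≡ x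

  ConstantExpressive : Set
  ConstantExpressive = ∀ x → ∃ λ A → ∀ v → v ∈ Valuation → eval v A ≡ x

  module _ (_⊨_ : TruthRelation 𝒱) where

    Consequence : Rel (Pred Form 0ℓ) 0ℓ
    Consequence Γ Δ = ∀ v → v ∈ Valuation → image v Γ ⊨ image v Δ

    IsGNegation : Connective 1 → Set₁
    IsGNegation neg = ∀ (Γ Δ : Pred Form 0ℓ) (A : Form) →
      (((Γ ∪ ｛ ¬′ A ｝) ⊢ Δ) ⇔ (Γ ⊢ (｛ A ｝ ∪ Δ))) ×
      ((Γ ⊢ (｛ ¬′ A ｝ ∪ Δ)) ⇔ ((Γ ∪ ｛ A ｝) ⊢ Δ))
      where
      _⊢_ = Consequence
      ¬′_ : Form → Form
      ¬′ A = app neg (A ∷ [])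

    AdmitsGNegation : Set₁
    AdmitsGNegation = ∃ IsGNegation

{-# OPTIONS --safe #-}

-- Each Dpᵢ with the complement of Dcᵢ is a maximal counterexample of ⊨, by
-- minimality of the representation.  Above such a maximal pair, ⊨ coincides with
-- its i-th component alone, so the two equivalences defining a G-negation, tested
-- on constant formulas, say that the truth function f of the negation satisfies
-- f x ∈ Dpᵢ iff x ∉ Dcᵢ, and f x ∈ Dcᵢ iff x ∉ Dpᵢ.  Taking preimages under f
-- turns any inclusion between these sets into the reverse inclusion between their
-- partners, which is (N2); for (N1), it would make one component redundant.

module Submission where

open import Data.Empty using (⊥-elim)
open import Data.Fin.Base using (Fin; zero; suc)
open import Data.Fin.Properties using (any?; _≟_)
open import Data.Fin.Subset using (_⊆_; _∈_; _∉_; Subset)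
open import Data.Fin.Subset.Properties using (_∈?_)
open import Data.List.Base using (List; length; lookup; removeAt; _∷_)
open import Data.List.Properties using (length-removeAt′)
open import Data.List.Relation.Unary.All using (All; _∷_; tabulate)
import Data.List.Relation.Unary.All as All
open import Data.List.Membership.Propositional.Properties using (∈-lookup)
open import Data.List.Relation.Unary.Any.Properties using (lookup-index)
open import Data.List.Relation.Unary.Any using (index)
open import Data.Nat.Base using (_≤_)
open import Data.Nat.Properties using (1+n≰n)
open import Data.Product.Base using (_×_; _,_; ∃; proj₁; proj₂)
open import Data.Sum.Base using (inj₁; inj₂)
open import Data.Vec.Base using ([]; _∷_)
open import Function.Base using (_∘_)
open import Function.Bundles using (_⇔_; mk⇔; Equivalence)
open import Level using (Level; 0ℓ)
open import Relation.Binary.PropositionalEquality.Core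
  using (_≡_; _≢_; refl; sym; trans; cong; subst)
open import Relation.Nullary.Decidable using (yes; no; decidable-stable; _×-dec_; ¬?)
open import Relation.Nullary.Negation.Core using (¬_)
import Relation.Unary as U
open U using (Pred; _∪_; ｛_｝)
open import Defs

open Equivalence using (to; from)

private
  variable
    a p : Level
    A : Set a
    P : Pred A p

-- Membership is decidable and the carrier finite, so a search finds the witness constructively.
⊈⇒∃∉ : ∀ {n} {p q : Subset n} → ¬ (p ⊆ q) → ∃ λ x → x ∈ p × x ∉ q
⊈⇒∃∉ {p = p} {q} p⊈q with any? (λ x → (x ∈? p) ×-dec ¬? (x ∈? q))
... | yes witness = witness
... | no  none    = ⊥-elim (p⊈q λ {x} x∈p →
  decidable-stable (x ∈? q) λ x∉q → none (x , x∈p , x∉q))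

All-lookup : ∀ {xs : List A} → All P xs → ∀ i → P (lookup xs i)
All-lookup all i = All.lookup all (∈-lookup i)

lookup-All : ∀ {xs : List A} → (∀ i → P (lookup xs i)) → All P xs
lookup-All {P = P} h =
  tabulate λ x∈xs → subst P (sym (lookup-index x∈xs)) (h (index x∈xs))

All-removeAt⁺ : ∀ {xs : List A} → All P xs → ∀ i → All P (removeAt xs i)
All-removeAt⁺ (_ ∷ pxs)  zero    = pxs
All-removeAt⁺ (px ∷ pxs) (suc i) = px ∷ All-removeAt⁺ pxs i

All-removeAt⇒lookup : ∀ (xs : List A) {i j} → i ≢ j →
                      All P (removeAt xs i) → P (lookup xs j)
All-removeAt⇒lookup (_ ∷ _)  {zero}  {zero}  i≢j _          = ⊥-elim (i≢j refl)
All-removeAt⇒lookup (_ ∷ _)  {zero}  {suc j} _   pxs        = All-lookup pxs j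
All-removeAt⇒lookup (_ ∷ _)  {suc _} {zero}  _   (px ∷ _)   = px
All-removeAt⇒lookup (_ ∷ xs) {suc _} {suc _} i≢j (_ ∷ pxs)  =
  All-removeAt⇒lookup xs (i≢j ∘ cong suc) pxs

All-removeAt⁻ : ∀ (xs : List A) i → P (lookup xs i) →
                All P (removeAt xs i) → All P xs
All-removeAt⁻ (_ ∷ _)  zero    px pxs        = px ∷ pxs
All-removeAt⁻ (_ ∷ xs) (suc i) px (py ∷ pxs) = py ∷ All-removeAt⁻ xs i px pxs

module _ (𝒱 : TruthValues) (_⊨_ : TruthRelation 𝒱) where
  open TruthValues 𝒱
  open Mixed using (Dp; Dc; relation)

  -- Besides weakening, this makes `_⊨_` respect extensional equality of predicates, which an
  -- arbitrary relation on `Pred V 0ℓ` need not do.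
  Monotone : Set₁
  Monotone = ∀ {γ γ′ δ δ′} → γ U.⊆ γ′ → δ U.⊆ δ′ → γ ⊨ δ → γ′ ⊨ δ′

  represents⇒monotone : ∀ {Ms} → Represents 𝒱 Ms _⊨_ → Monotone
  represents⇒monotone rep {γ} {γ′} {δ} {δ′} γ⊆γ′ δ⊆δ′ γ⊨δ =
    from (rep γ′ δ′) (All.map (λ {M} → weaken M) (to (rep γ δ) γ⊨δ))
    where
    weaken : ∀ M → relation M γ δ → relation M γ′ δ′
    weaken _ r γ′⊆Dp = let x , x∈δ , x∈Dc = r (γ′⊆Dp ∘ γ⊆γ′) in x , δ⊆δ′ x∈δ , x∈Dc

  -- The G-negation equivalences moved from formulas to truth values, where they can be tested at
  -- the designated sets themselves.
  record NegatedBy (f : V → V) : Set₁ where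
    field
      ¬-left  : ∀ γ δ x → ((γ ∪ ｛ f x ｝) ⊨ δ) ⇔ (γ ⊨ (｛ x ｝ ∪ δ))
      ¬-right : ∀ γ δ x → (γ ⊨ (｛ f x ｝ ∪ δ)) ⇔ ((γ ∪ ｛ x ｝) ⊨ δ)

  module _ (S : Semantics 𝒱) (constant : Semantics.ConstantExpressive S)
           (mono : Monotone) where
    open Semantics S

    private
      _⊢_ : Pred Form 0ℓ → Pred Form 0ℓ → Set
      _⊢_ = Consequence _⊨_

      const : V → Form
      const x = proj₁ (constant x)

      consts : Pred V 0ℓ → Pred Form 0ℓ
      consts γ A = ∃ λ x → x U.∈ γ × A ≡ const x

      -- Because the image does not vary with the valuation, the quantifier in `Consequence`
      -- collapses on such sets.
      Denotes : Pred Form 0ℓ → Pred V 0ℓ → Set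
      Denotes Γ γ = ∀ {v} → v U.∈ Valuation → image v Γ U.≐ γ

      ⊢⇔⊨ : ∀ {Γ Δ γ δ} → Denotes Γ γ → Denotes Δ δ → (Γ ⊢ Δ) ⇔ (γ ⊨ δ)
      ⊢⇔⊨ Γ≐γ Δ≐δ = mk⇔
        -- Realizing the empty assignment yields some valuation, so `Γ ⊢ Δ` does not hold vacuously.
        (λ Γ⊢Δ → let v , v∈ , _ = realized {0} (λ ()) (λ {}) (λ ())
                 in mono (proj₁ (Γ≐γ v∈)) (proj₁ (Δ≐δ v∈)) (Γ⊢Δ v v∈))
        (λ γ⊨δ v v∈ → mono (proj₂ (Γ≐γ v∈)) (proj₂ (Δ≐δ v∈)) γ⊨δ)

      consts-denotes : ∀ γ → Denotes (consts γ) γ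
      consts-denotes γ {v} v∈ =
        (λ { (_ , (x , x∈γ , refl) , eq) →
             subst γ (trans (sym (proj₂ (constant x) v v∈)) eq) x∈γ }) ,
        (λ {x} x∈γ → const x , (x , x∈γ , refl) , proj₂ (constant x) v v∈)

      ∪-denotes : ∀ {Γ Δ γ δ} → Denotes Γ γ → Denotes Δ δ →
                  Denotes (Γ ∪ Δ) (γ ∪ δ)
      ∪-denotes Γ≐γ Δ≐δ v∈ =
        (λ { (A , inj₁ A∈Γ , eq) → inj₁ (proj₁ (Γ≐γ v∈) (A , A∈Γ , eq))
           ; (A , inj₂ A∈Δ , eq) → inj₂ (proj₁ (Δ≐δ v∈) (A , A∈Δ , eq)) }) ,
        (λ { (inj₁ x∈γ) → let A , A∈Γ , eq = proj₂ (Γ≐γ v∈) x∈γ in A , inj₁ A∈Γ , eq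
           ; (inj₂ x∈δ) → let A , A∈Δ , eq = proj₂ (Δ≐δ v∈) x∈δ in A , inj₂ A∈Δ , eq })

      singleton-denotes : ∀ {A x} → (∀ v → v U.∈ Valuation → eval v A ≡ x) →
                          Denotes ｛ A ｝ ｛ x ｝
      singleton-denotes {A} A≡x {v} v∈ =
        (λ { (_ , refl , eq) → trans (sym (A≡x v v∈)) eq }) ,
        (λ { refl → A , refl , A≡x v v∈ })

    -- Sets of constant formulas denote every pair of sets of values, and by compositionality the
    -- negation of a constant formula is again constant.
    gNegation⇒negatedBy : ∀ {neg} → IsGNegation _⊨_ neg →
                          NegatedBy (λ x → ⟦ neg ⟧ (x ∷ []))
    gNegation⇒negatedBy {neg} isNeg = record
      { ¬-left  = λ γ δ x → transport
          (∪-denotes (consts-denotes γ) (negated x)) (consts-denotes δ)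
          (consts-denotes γ) (∪-denotes (plain x) (consts-denotes δ))
          (proj₁ (isNeg (consts γ) (consts δ) (const x)))
      ; ¬-right = λ γ δ x → transport
          (consts-denotes γ) (∪-denotes (negated x) (consts-denotes δ))
          (∪-denotes (consts-denotes γ) (plain x)) (consts-denotes δ)
          (proj₂ (isNeg (consts γ) (consts δ) (const x)))
      }
      where
      plain : ∀ x → Denotes ｛ const x ｝ ｛ x ｝
      plain x = singleton-denotes (proj₂ (constant x))

      negated : ∀ x → Denotes ｛ app neg (const x ∷ []) ｝ ｛ ⟦ neg ⟧ (x ∷ []) ｝
      negated x = singleton-denotes λ v v∈ →
        cong (λ y → ⟦ neg ⟧ (y ∷ [])) (proj₂ (constant x) v v∈)

      transport : ∀ {Γ Δ Γ′ Δ′ γ δ γ′ δ′} →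
                  Denotes Γ γ → Denotes Δ δ → Denotes Γ′ γ′ → Denotes Δ′ δ′ →
                  (Γ ⊢ Δ) ⇔ (Γ′ ⊢ Δ′) → (γ ⊨ δ) ⇔ (γ′ ⊨ δ′)
      transport Γ≐γ Δ≐δ Γ′≐γ′ Δ′≐δ′ e = mk⇔
        (to (⊢⇔⊨ Γ′≐γ′ Δ′≐δ′) ∘ to e ∘ from (⊢⇔⊨ Γ≐γ Δ≐δ))
        (to (⊢⇔⊨ Γ≐γ Δ≐δ) ∘ from e ∘ from (⊢⇔⊨ Γ′≐γ′ Δ′≐δ′))

  module _ {Ms : List (Mixed 𝒱)} (minimal : MinimalRepresentation 𝒱 Ms _⊨_) where

    private
      M : Fin (length Ms) → Mixed 𝒱
      M = lookup Ms

      represents : Represents 𝒱 Ms _⊨_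
      represents = proj₁ minimal

    -- Under both inclusions component `j` implies component `i`, so deleting `i` would leave a
    -- shorter representation.
    minimal⇒irredundant : ∀ {i j} → i ≢ j →
                          Dp (M i) ⊆ Dp (M j) → ¬ (Dc (M j) ⊆ Dc (M i))
    minimal⇒irredundant {i} {j} i≢j Dpᵢ⊆Dpⱼ Dcⱼ⊆Dcᵢ =
      1+n≰n (subst (λ n → n ≤ length (removeAt Ms i)) (length-removeAt′ Ms i)
                   (proj₂ minimal (removeAt Ms i) represents′))
      where
      implied : ∀ {γ δ} → relation (M j) γ δ → relation (M i) γ δ
      implied r γ⊆Dpᵢ = let x , x∈δ , x∈Dcⱼ = r (Dpᵢ⊆Dpⱼ ∘ γ⊆Dpᵢ)
                        in x , x∈δ , Dcⱼ⊆Dcᵢ x∈Dcⱼ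

      represents′ : Represents 𝒱 (removeAt Ms i) _⊨_
      represents′ γ δ = mk⇔
        (λ γ⊨δ → All-removeAt⁺ (to (represents γ δ) γ⊨δ) i)
        (λ all → from (represents γ δ) (All-removeAt⁻ Ms i
          (implied {γ} {δ} (All-removeAt⇒lookup Ms i≢j all)) all))

    -- Every component other than `i` holds automatically for such `γ` and `δ`, so only component
    -- `i` can fail.
    ⊨⇔relation : ∀ i γ δ → (_∈ Dp (M i)) U.⊆ γ → (_∉ Dc (M i)) U.⊆ δ →
                 (γ ⊨ δ) ⇔ relation (M i) γ δ
    ⊨⇔relation i γ δ Dpᵢ⊆γ ∁Dcᵢ⊆δ = mk⇔
      (λ γ⊨δ → All-lookup (to (represents γ δ) γ⊨δ) i)
      (λ r → from (represents γ δ) (lookup-All (component r)))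
      where
      component : relation (M i) γ δ → ∀ j → relation (M j) γ δ
      component r j γ⊆Dpⱼ with i ≟ j
      ... | yes refl = r γ⊆Dpⱼ
      ... | no  i≢j  =
        -- The premise sets satisfy `Dp (M i)` ⊆ `γ` ⊆ `Dp (M j)`, so irredundancy forbids the
        -- inclusion of conclusion sets and supplies a value outside `Dc (M i)`, hence in `δ`.
        let x , x∈Dcⱼ , x∉Dcᵢ = ⊈⇒∃∉ (minimal⇒irredundant i≢j (γ⊆Dpⱼ ∘ Dpᵢ⊆γ))
        in x , ∁Dcᵢ⊆δ x∉Dcᵢ , x∈Dcⱼ

    private
      -- The pair without `x` is a counterexample to component `i`; a new premise repairs it exactly
      -- when it leaves `Dp (M i)`.
      ⊨-addPremise : ∀ i x →
        (((_∈ Dp (M i)) ∪ ｛ x ｝) ⊨ (_∉ Dc (M i))) ⇔ (x ∉ Dp (M i))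
      ⊨-addPremise i x = mk⇔
        (λ γ⊨δ x∈Dp →
          let y , y∉Dc , y∈Dc = to ⊨⇔rel γ⊨δ λ { (inj₁ y∈Dp) → y∈Dp ; (inj₂ refl) → x∈Dp }
          in y∉Dc y∈Dc)
        (λ x∉Dp → from ⊨⇔rel λ γ⊆Dp → ⊥-elim (x∉Dp (γ⊆Dp (inj₂ refl))))
        where ⊨⇔rel = ⊨⇔relation i ((_∈ Dp (M i)) ∪ ｛ x ｝) (_∉ Dc (M i)) inj₁ (λ y∉ → y∉)

      -- Dually, only a conclusion designated in component `i` repairs the counterexample.
      ⊨-addConclusion : ∀ i x →
        ((_∈ Dp (M i)) ⊨ (｛ x ｝ ∪ (_∉ Dc (M i)))) ⇔ (x ∈ Dc (M i))
      ⊨-addConclusion i x = mk⇔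
        (λ γ⊨δ → split (to ⊨⇔rel γ⊨δ (λ y∈ → y∈)))
        (λ x∈Dc → from ⊨⇔rel λ _ → x , inj₁ refl , x∈Dc)
        where
        ⊨⇔rel = ⊨⇔relation i (_∈ Dp (M i)) (｛ x ｝ ∪ (_∉ Dc (M i))) (λ y∈ → y∈) inj₂
        split : (∃ λ y → y U.∈ (｛ x ｝ ∪ (_∉ Dc (M i))) × y ∈ Dc (M i)) → x ∈ Dc (M i)
        split (_ , inj₁ refl , x∈Dc) = x∈Dc
        split (_ , inj₂ y∉Dc , y∈Dc) = ⊥-elim (y∉Dc y∈Dc)

    module _ {f : V → V} (negatedBy : NegatedBy f) where
      open NegatedBy negatedBy

      -- Both sides say that the maximal counterexample is repaired: on the left by the premise
      -- `f x`, on the right by the conclusion `x`.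
      f∉Dp⇔∈Dc : ∀ i x → (f x ∉ Dp (M i)) ⇔ (x ∈ Dc (M i))
      f∉Dp⇔∈Dc i x = mk⇔
        (to (⊨-addConclusion i x) ∘ to neg ∘ from (⊨-addPremise i (f x)))
        (to (⊨-addPremise i (f x)) ∘ from neg ∘ from (⊨-addConclusion i x))
        where neg = ¬-left (_∈ Dp (M i)) (_∉ Dc (M i)) x

      f∈Dc⇔∉Dp : ∀ i x → (f x ∈ Dc (M i)) ⇔ (x ∉ Dp (M i))
      f∈Dc⇔∉Dp i x = mk⇔
        (to (⊨-addPremise i x) ∘ to neg ∘ from (⊨-addConclusion i (f x)))
        (to (⊨-addConclusion i (f x)) ∘ from neg ∘ from (⊨-addPremise i x))
        where neg = ¬-right (_∈ Dp (M i)) (_∉ Dc (M i)) x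

      -- The set `Dc (M i)` is the complement of the preimage of `Dp (M i)` under `f`, and
      -- complementation reverses inclusions.
      Dp⊆Dp⇒Dc⊆Dc : ∀ {i j} → Dp (M i) ⊆ Dp (M j) → Dc (M j) ⊆ Dc (M i)
      Dp⊆Dp⇒Dc⊆Dc {i} {j} Dpᵢ⊆Dpⱼ {x} x∈Dcⱼ =
        to (f∉Dp⇔∈Dc i x) (from (f∉Dp⇔∈Dc j x) x∈Dcⱼ ∘ Dpᵢ⊆Dpⱼ)

      Dc⊆Dc⇒Dp⊆Dp : ∀ {i j} → Dc (M i) ⊆ Dc (M j) → Dp (M j) ⊆ Dp (M i)
      -- Preimages of `Dc` determine only non-membership in `Dp`; decidability removes the double
      -- negation.
      Dc⊆Dc⇒Dp⊆Dp {i} {j} Dcᵢ⊆Dcⱼ {x} x∈Dpⱼ = decidable-stable (x ∈? Dp (M i)) λ x∉Dpᵢ →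
        to (f∈Dc⇔∉Dp j x) (Dcᵢ⊆Dcⱼ (from (f∈Dc⇔∉Dp i x) x∉Dpᵢ)) x∈Dpⱼ

      -- Both equivalences combine: `x ∈ Dp (M j)` gives `f x ∉ Dc (M j)`, so `f x ∉ Dp (M i)`, so
      -- `x ∈ Dc (M i)`.
      Dp⊆Dc⇒Dp⊆Dc : ∀ {i j} → Dp (M i) ⊆ Dc (M j) → Dp (M j) ⊆ Dc (M i)
      Dp⊆Dc⇒Dp⊆Dc {i} {j} Dpᵢ⊆Dcⱼ {x} x∈Dpⱼ =
        to (f∉Dp⇔∈Dc i x) λ fx∈Dpᵢ → to (f∈Dc⇔∉Dp j x) (Dpᵢ⊆Dcⱼ fx∈Dpᵢ) x∈Dpⱼ

      Dc⊆Dp⇒Dc⊆Dp : ∀ {i j} → Dc (M j) ⊆ Dp (M i) → Dc (M i) ⊆ Dp (M j)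
      Dc⊆Dp⇒Dc⊆Dp {i} {j} Dcⱼ⊆Dpᵢ {x} x∈Dcᵢ = decidable-stable (x ∈? Dp (M j)) λ x∉Dpⱼ →
        from (f∉Dp⇔∈Dc i x) x∈Dcᵢ (Dcⱼ⊆Dpᵢ (from (f∈Dc⇔∉Dp j x) x∉Dpⱼ))

theorem7p8 :
    (𝒱 : TruthValues) (_⊨_ : TruthRelation 𝒱) →
    IntersectiveMixed 𝒱 _⊨_ →
    (S : Semantics 𝒱) →
    Semantics.ConstantExpressive S →
    Semantics.AdmitsGNegation S _⊨_ →
    (Ms : List (Mixed 𝒱)) →
    MinimalRepresentation 𝒱 Ms _⊨_ →
    let Dp = λ (i : Fin (length Ms)) → Mixed.Dp (lookup Ms i)
        Dc = λ (i : Fin (length Ms)) → Mixed.Dc (lookup Ms i)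
    in
    (∀ i j → i ≢ j → ¬ (Dp i ⊆ Dp j) × ¬ (Dc i ⊆ Dc j)) ×
    (∀ i j → (Dp i ⊆ Dc j → Dp j ⊆ Dc i) × (Dc j ⊆ Dp i → Dc i ⊆ Dp j))
theorem7p8 𝒱 _⊨_ _ S constant (_ , isNeg) Ms minimal =
  (λ i j i≢j →
    (λ Dpᵢ⊆Dpⱼ → minimal⇒irredundant 𝒱 _⊨_ minimal i≢j Dpᵢ⊆Dpⱼ
      (Dp⊆Dp⇒Dc⊆Dc 𝒱 _⊨_ minimal negatedBy {i} {j} Dpᵢ⊆Dpⱼ)) ,
    -- The roles are exchanged here: component `i` implies component `j`, so `j` is the redundant
    -- one.
    (λ Dcᵢ⊆Dcⱼ → minimal⇒irredundant 𝒱 _⊨_ minimal (i≢j ∘ sym)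
      (Dc⊆Dc⇒Dp⊆Dp 𝒱 _⊨_ minimal negatedBy {i} {j} Dcᵢ⊆Dcⱼ) Dcᵢ⊆Dcⱼ)) ,
  (λ i j →
    Dp⊆Dc⇒Dp⊆Dc 𝒱 _⊨_ minimal negatedBy {i} {j} ,
    Dc⊆Dp⇒Dc⊆Dp 𝒱 _⊨_ minimal negatedBy {i} {j})
  where
  negatedBy = gNegation⇒negatedBy 𝒱 _⊨_ S constant
    (represents⇒monotone 𝒱 _⊨_ (proj₁ minimal)) isNeg
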